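{- Let $\mathfrak M$ be a relational $\mathfrak L$-structure with domain $\Sigma$. The emptiness problem for $MSO^+_R(\mathfrak M)$-definable languages (given an $MSO^+_R(\mathfrak L)$-sentence $\psi$, decide whether some word $w\in\Sigma^*$ satisfies $\psi$) is (effectively) reducible to the first-order theory of $\mathfrak M$; in particular it is decidable whenever the first-order theory of $\mathfrak M$ is decidable.
   Context: Let $\#\notin\Sigma$ and let $\mathfrak M_\#$ be the structure in the language $\mathfrak L_\#=\mathfrak L\cup\{P_\#\}$ with domain $\Sigma\cup\{\#\}$, every symbol of $\mathfrak L$ interpreted as in $\mathfrak M$ and $P_\#(x)$ holding iff $x=\#$. To every first-order $\mathfrak L_\#$-formula $F$ with $m\ge1$ free variables associate a new $m$-ary relation symbol $\theta_F$. $MSO^+(\mathfrak L)$ is monadic second-order logic over the signature $\{<\}\cup\{\theta_F\}$. A word $w\in\Sigma^*$ is viewed as the structure with domain $\{0,\dots,|w|-1\}$ (positions), $<$ the natural order, and $\theta_F(x_1,\dots,x_m)$ holding iff $\mathfrak M_\#\models F(w[x_1],\dots,w[x_m])$, where $w[x]$ is the letter at position $x$; the language defined by a sentence is the set of words satisfying it. $MSO^+_R(\mathfrak L)$ is the set of $MSO^+(\mathfrak L)$-sentences of the form $\exists x_1\cdots\exists x_n\,\varphi(x_1,\dots,x_n)$ (first-order variables $x_i$) where every atomic formula of the form $\theta_F(\dots)$ occurring in $\varphi$ has the form $\theta_F(x_1,\dots,x_n,y)$, i.e. contains at most one free variable distinct from $x_1,\dots,x_n$. A language is $MSO^+_R(\mathfrak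 M)$-definable if it is defined by an $MSO^+_R(\mathfrak L)$-sentence. -}

module Defs where

open import Data.Bool using (Bool)
open import Data.Fin as Fin using (Fin; _↑ʳ_)
open import Data.Fin.Subset as Subset using (Subset)
open import Data.List using (List; length)
import Data.List as List
open import Data.Maybe using (Maybe; just; nothing)
open import Data.Nat using (ℕ; zero; suc; _+_)
open import Data.Product using (Σ; Σ-syntax; ∃-syntax; _×_; proj₁)
open import Data.Sum using (_⊎_)
open import Data.Unit using (⊤)
open import Data.Vec using (Vec; []; _∷_; lookup; map)
open import Data.Vec.Relation.Unary.All using (All)
open import Function.Bundles using (_⇔_)
open import Level using (0ℓ)
open import Relation.Binary.PropositionalEquality using (_≡_)
open import Relation.Nullary using (¬_; Reflects)
open import Relation.Unary using (Pred; Satisfiable)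

------------------------------------------------------------------------
-- First-order logic with equality over relational signatures

record Signature : Set₁ where
  field
    Symbol : Set
    arity  : Symbol → ℕ

open Signature public

record Structure (L : Signature) : Set₁ where
  field
    Domain : Set
    ⟦_⟧    : (R : Symbol L) → Pred (Vec Domain (arity L R)) 0ℓ

open Structure public

-- Formulas with free variables among Fin n; a quantifier binds the
-- variable zero of its body.
data Formula (L : Signature) (n : ℕ) : Set where
  rel         : (R : Symbol L) → Vec (Fin n) (arity L R) → Formula L n
  _≐_         : Fin n → Fin n → Formula L n
  ¬′_         : Formula L n → Formula L n
  _∧′_ _∨′_   : Formula L n → Formula L n → Formula L n
  ∃′_ ∀′_     : Formula L (suc n) → Formula L n

Sentence : Signature → Set
Sentence L = Formula L 0

Sat : ∀ {L n} (M : Structure L) → Vec (Domain M) n → Formula L n → Set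
Sat M ρ (rel R xs) = ⟦ M ⟧ R (map (lookup ρ) xs)
Sat M ρ (x ≐ y)    = lookup ρ x ≡ lookup ρ y
Sat M ρ (¬′ φ)     = ¬ Sat M ρ φ
Sat M ρ (φ ∧′ χ)   = Sat M ρ φ × Sat M ρ χ
Sat M ρ (φ ∨′ χ)   = Sat M ρ φ ⊎ Sat M ρ χ
Sat M ρ (∃′ φ)     = ∃[ a ] Sat M (a ∷ ρ) φ
Sat M ρ (∀′ φ)     = ∀ a → Sat M (a ∷ ρ) φ

Theory : ∀ {L} → Structure L → Pred (Sentence L) 0ℓ
Theory M φ = Sat M [] φ

------------------------------------------------------------------------
-- The expansion by a fresh element #, represented by nothing

data Symbol# (L : Signature) : Set where
  old : Symbol L → Symbol# L
  P#  : Symbol# L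

infix 30 _♯

_♯ : Signature → Signature
L ♯ = record
  { Symbol = Symbol# L
  ; arity  = λ { (old R) → arity L R ; P# → 1 }
  }

-- The symbols of L keep their extension, so they fail on every tuple
-- in which # occurs.
expand : ∀ {L} → Structure L → Structure (L ♯)
expand M = record
  { Domain = Maybe (Domain M)
  ; ⟦_⟧    = λ { (old R) xs       → ∃[ as ] (xs ≡ map just as × ⟦ M ⟧ R as)
               ; P#      (x ∷ []) → x ≡ nothing }
  }

------------------------------------------------------------------------
-- Monadic second-order logic over words

-- n counts the first-order variables in scope and k the set variables.
-- In θ F xs, the variable i of F stands for the letter at position
-- lookup xs i; F has at least one variable.
data MSO⁺ (L : Signature) (n k : ℕ) : Set where
  _<′_ _≐_    : Fin n → Fin n → MSO⁺ L n k
  _∈′_        : Fin n → Fin k → MSO⁺ L n k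
  θ           : ∀ {m} → Formula (L ♯) (suc m) → Vec (Fin n) (suc m) →
                MSO⁺ L n k
  ¬′_         : MSO⁺ L n k → MSO⁺ L n k
  _∧′_ _∨′_   : MSO⁺ L n k → MSO⁺ L n k → MSO⁺ L n k
  ∃₁_ ∀₁_     : MSO⁺ L (suc n) k → MSO⁺ L n k
  ∃₂_ ∀₂_     : MSO⁺ L n (suc k) → MSO⁺ L n k

module _ {L : Signature} (M : Structure L) (w : List (Domain M)) where

  Position : Set
  Position = Fin (length w)

  WordSat : ∀ {n k} → Vec Position n → Vec (Subset (length w)) k →
            MSO⁺ L n k → Set
  WordSat ρ σ (x <′ y)  = lookup ρ x Fin.< lookup ρ y
  WordSat ρ σ (x ≐ y)   = lookup ρ x ≡ lookup ρ y
  WordSat ρ σ (x ∈′ X)  = lookup ρ x Subset.∈ lookup σ X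
  WordSat ρ σ (θ F xs)  =
    Sat (expand M) (map (λ x → just (List.lookup w (lookup ρ x))) xs) F
  WordSat ρ σ (¬′ φ)    = ¬ WordSat ρ σ φ
  WordSat ρ σ (φ ∧′ χ)  = WordSat ρ σ φ × WordSat ρ σ χ
  WordSat ρ σ (φ ∨′ χ)  = WordSat ρ σ φ ⊎ WordSat ρ σ χ
  WordSat ρ σ (∃₁ φ)    = ∃[ p ] WordSat (p ∷ ρ) σ φ
  WordSat ρ σ (∀₁ φ)    = ∀ p → WordSat (p ∷ ρ) σ φ
  WordSat ρ σ (∃₂ φ)    = ∃[ S ] WordSat ρ (S ∷ σ) φ
  WordSat ρ σ (∀₂ φ)    = ∀ S → WordSat ρ (S ∷ σ) φ

Language : ∀ {L} (M : Structure L) → MSO⁺ L 0 0 → Pred (List (Domain M)) 0ℓ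
Language M ψ w = WordSat M w [] [] ψ

------------------------------------------------------------------------
-- The fragment MSO⁺_R

∃* : ∀ {L} n → MSO⁺ L n 0 → MSO⁺ L 0 0
∃* zero    φ = φ
∃* (suc n) φ = ∃* n (∃₁ φ)

-- φ is a subformula lying below d first-order quantifiers, so that the
-- variables x₁, …, xₙ of the prefix appear in it as d ↑ʳ i.
Restricted : ∀ {L} n d {k} → MSO⁺ L (d + n) k → Set
Restricted n d (x <′ y) = ⊤
Restricted n d (x ≐ y)  = ⊤
Restricted n d (x ∈′ X) = ⊤
Restricted n d (θ F xs) =
  ∃[ y ] All (λ x → (Σ[ i ∈ Fin n ] x ≡ d ↑ʳ i) ⊎ x ≡ y) xs
Restricted n d (¬′ φ)   = Restricted n d φ
Restricted n d (φ ∧′ χ) = Restricted n d φ × Restricted n d χ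
Restricted n d (φ ∨′ χ) = Restricted n d φ × Restricted n d χ
Restricted n d (∃₁ φ)   = Restricted n (suc d) φ
Restricted n d (∀₁ φ)   = Restricted n (suc d) φ
Restricted n d (∃₂ φ)   = Restricted n d φ
Restricted n d (∀₂ φ)   = Restricted n d φ

InMSO⁺R : ∀ {L} → MSO⁺ L 0 0 → Set
InMSO⁺R {L} ψ =
  Σ[ n ∈ ℕ ] Σ[ φ ∈ MSO⁺ L n 0 ] (Restricted n 0 φ × ψ ≡ ∃* n φ)

MSO⁺R : Signature → Set
MSO⁺R L = Σ (MSO⁺ L 0 0) InMSO⁺R

-- As usual for "the emptiness problem", the positive instances are the
-- sentences satisfied by some word.
Emptiness : ∀ {L} → Structure L → Pred (MSO⁺R L) 0ℓ
Emptiness M ψ = Satisfiable (Language M (proj₁ ψ))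

------------------------------------------------------------------------
-- Decision procedures and reductions, in the synthetic sense: being
-- effective means being a function definable without axioms.  Hence
-- excluded middle may be assumed for the correctness of a decider or a
-- reduction, but not for its construction.

_Decides_ : {A : Set} → (A → Bool) → Pred A 0ℓ → Set
d Decides P = ∀ a → Reflects (P a) (d a)

_Reduces_To_ : {A B : Set} → (A → B) → Pred A 0ℓ → Pred B 0ℓ → Set
f Reduces P To Q = ∀ a → P a ⇔ Q (f a)

{-# OPTIONS --safe #-}

-- A satisfiable sentence ∃ x₁ … xₙ φ has a model of bounded length.  Fix
-- the letters a₁, …, aₙ at x₁, …, xₙ.  Each atom θ F (x₁, …, xₙ, y) then
-- depends on the letter at y only, so the words satisfying φ, with the
-- values of the variables written along them, form a language of finite
-- Nerode index over a possibly infinite alphabet.  The index is bounded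
-- by recursion on φ, independently of the structure and of a₁, …, aₙ, and
-- pumping gives a model shorter than the bound.  For words of a fixed
-- length ℓ, quantifiers over positions and sets of positions are finite
-- disjunctions or conjunctions, so satisfiability is the first-order
-- statement that suitable letters b₁, …, b_ℓ exist.
module Submission where

open import Axiom.ExcludedMiddle using (ExcludedMiddle)
open import Data.Bool using (Bool; true; false)
open import Data.Fin as Fin using (Fin; zero; suc; toℕ; fromℕ<; combine; funToFin; finToFun; _↑ʳ_)
import Data.Fin.Properties as Fin
open import Data.Fin.Subset as Subset using (Subset)
open import Data.Fin.Subset.Properties using (_∈?_)
open import Data.List as List using (List; []; _∷_; _++_; length; take; drop)
import Data.List.Properties as List
open import Data.List.Relation.Unary.Any as Any using (Any; here; there)
import Data.List.Relation.Unary.Any.Properties as Any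
open import Data.Maybe as Maybe using (Maybe; just; nothing)
import Data.Maybe.Properties as Maybe
open import Data.Nat using (ℕ; zero; suc; _+_; _*_; _^_; _∸_; _⊓_; _<_; z≤n; s≤s; s≤s⁻¹)
import Data.Nat.Properties as ℕ
open import Data.Nat.Induction using (<-wellFounded)
open import Data.Product using (Σ-syntax; ∃; ∃-syntax; _×_; _,_; proj₁; proj₂)
open import Data.Product.Function.NonDependent.Propositional using (_×-⇔_)
open import Data.Sum as Sum using (_⊎_; inj₁; inj₂)
open import Data.Sum.Function.Propositional using (_⊎-⇔_)
open import Data.Vec as Vec using (Vec; []; _∷_; lookup; map)
import Data.Vec.Properties as Vec
open import Data.Vec.Relation.Unary.All as All using (All; []; _∷_)
open import Function using (_∘_)
open import Function.Bundles using (_⇔_; mk⇔; Equivalence)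
open import Function.Construct.Composition using (_⇔-∘_)
open import Function.Construct.Identity using (⇔-id)
open import Function.Construct.Symmetry using (⇔-sym)
open import Function.Related.TypeIsomorphisms using (¬-cong-⇔)
open import Induction.WellFounded using (Acc; acc)
open import Level using (0ℓ)
open import Relation.Binary.Definitions using (tri<; tri≈; tri>)
open import Relation.Binary.PropositionalEquality
  using (_≡_; _≗_; refl; sym; trans; cong; cong₂; subst; module ≡-Reasoning)
open import Relation.Nullary using (Dec; yes; no; does; ¬_; Reflects; contradiction)
open import Relation.Nullary.Decidable using (decidable-stable; map′)
open import Relation.Unary using (Pred; ∁; _∩_; _∪_; Satisfiable)
open import Defs

open Equivalence using (to; from)

-- Logical equivalences

≡⇒⇔ : ∀ {A B : Set} → A ≡ B → A ⇔ B
≡⇒⇔ refl = ⇔-id _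

∃-cong-⇔ : ∀ {A : Set} {P Q : A → Set} → (∀ a → P a ⇔ Q a) → ∃ P ⇔ ∃ Q
∃-cong-⇔ P⇔Q = mk⇔ (λ (a , p) → a , to (P⇔Q a) p) (λ (a , q) → a , from (P⇔Q a) q)

∀-cong-⇔ : ∀ {A : Set} {P Q : A → Set} →
           (∀ a → P a ⇔ Q a) → (∀ a → P a) ⇔ (∀ a → Q a)
∀-cong-⇔ P⇔Q = mk⇔ (λ p a → to (P⇔Q a) (p a)) (λ q a → from (P⇔Q a) (q a))

∀⇔¬∃¬ : ExcludedMiddle 0ℓ → ∀ {A : Set} {P : A → Set} →
        (∀ a → P a) ⇔ (¬ (∃[ a ] ¬ P a))
∀⇔¬∃¬ em = mk⇔ (λ p (a , ¬p) → ¬p (p a))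
               (λ ¬∃ a → decidable-stable em (λ ¬p → ¬∃ (a , ¬p)))

-- Languages of finite index

-- `class` refines the Nerode equivalence of `L`; one implication suffices in `transfer` because
-- equality of classes is symmetric. The bound `q` is a parameter of the type, so it stays
-- computable even where `class` is chosen by excluded middle.
record FiniteIndex {X : Set} (q : ℕ) (L : Pred (List X) 0ℓ) : Set where
  constructor _via_
  field
    class    : List X → Fin q
    transfer : ∀ {u v} → class u ≡ class v → ∀ x → L (u ++ x) → L (v ++ x)

open FiniteIndex

data Precedes {X : Set} (P Q : Pred X 0ℓ) : List X → Set where
  here  : ∀ {x u} → P x → Any Q u → Precedes P Q (x ∷ u)
  there : ∀ {x u} → Precedes P Q u → Precedes P Q (x ∷ u)

-- `Precedes P P` says that two different positions satisfy `P`, so its complement gives uniqueness.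
Once : ∀ {X : Set} → Pred X 0ℓ → Pred (List X) 0ℓ
Once P = Any P ∩ ∁ (Precedes P P)

-- Projection of a language; with `g` erasing the track of one variable it interprets an existential
-- quantifier.
Image : ∀ {X Y : Set} → (X → Y) → Pred (List X) 0ℓ → Pred (List Y) 0ℓ
Image g L u = ∃[ v ] (List.map g v ≡ u × L v)

map-++⁻ : ∀ {X Y : Set} (g : X → Y) v u {x} → List.map g v ≡ u ++ x →
          ∃[ v₁ ] ∃[ v₂ ] (v ≡ v₁ ++ v₂ × List.map g v₁ ≡ u × List.map g v₂ ≡ x)
map-++⁻ g v       []      eq = [] , v , refl , refl , eq
map-++⁻ g (a ∷ v) (b ∷ u) eq
  with v₁ , v₂ , refl , eq₁ , eq₂ ← map-++⁻ g v u (List.∷-injectiveʳ eq)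
  = a ∷ v₁ , v₂ , refl , cong₂ _∷_ (List.∷-injectiveˡ eq) eq₁ , eq₂

funToFin-injective : ∀ {m n} (f g : Fin m → Fin n) → funToFin f ≡ funToFin g → f ≗ g
funToFin-injective f g eq i = begin
  f i                      ≡⟨ Fin.finToFun-funToFin f i ⟨
  finToFun (funToFin f) i  ≡⟨ cong (λ k → finToFun k i) eq ⟩
  finToFun (funToFin g) i  ≡⟨ Fin.finToFun-funToFin g i ⟩
  g i                      ∎
  where open ≡-Reasoning

indicator : ∀ {P : Set} → Dec P → Fin 2
indicator (yes _) = suc zero
indicator (no  _) = zero

indicator-transfer : ∀ {P Q : Set} (p? : Dec P) (q? : Dec Q) →
                     indicator p? ≡ indicator q? → P → Q
indicator-transfer (yes _)  (yes q) _ _ = q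
indicator-transfer (no ¬p) _        _ p = contradiction p ¬p

precedes-++⁻ : ∀ {X : Set} {P Q : Pred X 0ℓ} u {x} → Precedes P Q (u ++ x) →
               Precedes P Q u ⊎ (Any P u × Any Q x) ⊎ Precedes P Q x
precedes-++⁻ []      r = inj₂ (inj₂ r)
precedes-++⁻ (a ∷ u) (here p q) with Any.++⁻ u q
... | inj₁ q₁ = inj₁ (here p q₁)
... | inj₂ q₂ = inj₂ (inj₁ (here p , q₂))
precedes-++⁻ (a ∷ u) (there r) with precedes-++⁻ u r
... | inj₁ r₁              = inj₁ (there r₁)
... | inj₂ (inj₁ (p , q))  = inj₂ (inj₁ (there p , q))
... | inj₂ (inj₂ r₂)       = inj₂ (inj₂ r₂)

precedes-++⁺ : ∀ {X : Set} {P Q : Pred X 0ℓ} u {x} →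
               Precedes P Q u ⊎ (Any P u × Any Q x) ⊎ Precedes P Q x →
               Precedes P Q (u ++ x)
precedes-++⁺ (a ∷ u) (inj₁ (here p q))            = here p (Any.++⁺ˡ q)
precedes-++⁺ (a ∷ u) (inj₁ (there r))             = there (precedes-++⁺ u (inj₁ r))
precedes-++⁺ (a ∷ u) (inj₂ (inj₁ (here p , q)))   = here p (Any.++⁺ʳ u q)
precedes-++⁺ (a ∷ u) (inj₂ (inj₁ (there p , q)))  = there (precedes-++⁺ u (inj₂ (inj₁ (p , q))))
precedes-++⁺ []      (inj₂ (inj₂ r))              = r
precedes-++⁺ (a ∷ u) (inj₂ (inj₂ r))              = there (precedes-++⁺ u (inj₂ (inj₂ r)))

-- Closure properties of finite index, and pumping

module _ {X : Set} where

  ∁-finite : ∀ {q} {L : Pred (List X) 0ℓ} → FiniteIndex q L → FiniteIndex q (∁ L)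
  ∁-finite (h via L-h) = h via λ eq x ¬l l → ¬l (L-h (sym eq) x l)

  ∩-finite : ∀ {p q} {K L : Pred (List X) 0ℓ} →
             FiniteIndex p K → FiniteIndex q L → FiniteIndex (p * q) (K ∩ L)
  ∩-finite (h via K-h) (k via L-k) = (λ u → combine (h u) (k u)) via λ eq x (a , b) →
    let eqʰ , eqᵏ = Fin.combine-injective _ _ _ _ eq in K-h eqʰ x a , L-k eqᵏ x b

  ∪-finite : ∀ {p q} {K L : Pred (List X) 0ℓ} →
             FiniteIndex p K → FiniteIndex q L → FiniteIndex (p * q) (K ∪ L)
  ∪-finite (h via K-h) (k via L-k) = (λ u → combine (h u) (k u)) via λ eq x →
    let eqʰ , eqᵏ = Fin.combine-injective _ _ _ _ eq in Sum.map (K-h eqʰ x) (L-k eqᵏ x)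

  ⋂-finite : ∀ {n q} {L : Fin n → Pred (List X) 0ℓ} →
             (∀ i → FiniteIndex q (L i)) → FiniteIndex (q ^ n) (λ u → ∀ i → L i u)
  ⋂-finite fin = (λ u → funToFin (λ i → class (fin i) u)) via λ eq x l i →
    transfer (fin i) (funToFin-injective _ _ eq i) x (l i)

  -- Two prefixes of a long word are in the same class, by the pigeonhole
  -- principle, and the factor between them can be cut out.
  shrink : ∀ {q} {L : Pred (List X) 0ℓ} → FiniteIndex q L →
           Satisfiable L → ∃[ u ] (length u < q × L u)
  shrink {q} {L} (h via L-h) (u , l) = go u (<-wellFounded (length u)) l
    where
    go : ∀ u → Acc _<_ (length u) → L u → ∃[ v ] (length v < q × L v)
    go u (acc rec) l with length u ℕ.<? q
    ... | yes u<q = u , u<q , l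
    ... | no  u≮q
      -- The empty and the full prefix both count, so there are `suc (length u)` prefixes, more than
      -- `q` as soon as `q` is at most `length u`.
      with i , j , i<j , eq ← Fin.pigeonhole (s≤s (ℕ.≮⇒≥ u≮q)) (λ i → h (take (toℕ {suc (length u)} i) u))
      = go v (rec shorter) (L-h (sym eq) (drop (toℕ j) u) (subst L (sym (List.take++drop≡id (toℕ j) u)) l))
      where
      v = take (toℕ i) u ++ drop (toℕ j) u
      open ℕ.≤-Reasoning
      shorter : length v < length u
      shorter = begin-strict
        length v                                               ≡⟨ List.length-++ (take (toℕ i) u) ⟩
        length (take (toℕ i) u) + length (drop (toℕ j) u)      ≡⟨ cong₂ _+_ (List.length-take (toℕ i) u) (List.length-drop (toℕ j) u) ⟩
        toℕ i ⊓ length u + (length u ∸ toℕ j)                  ≤⟨ ℕ.+-monoˡ-≤ _ (ℕ.m⊓n≤m (toℕ i) _) ⟩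
        toℕ i + (length u ∸ toℕ j)                             <⟨ ℕ.+-monoˡ-< _ i<j ⟩
        toℕ j + (length u ∸ toℕ j)                             ≡⟨ ℕ.m+[n∸m]≡n (s≤s⁻¹ (Fin.toℕ<n j)) ⟩
        length u                                               ∎

  module _ (em : ExcludedMiddle 0ℓ) where

    Any-finite : (P : Pred X 0ℓ) → FiniteIndex 2 (Any P)
    Any-finite P = (λ u → indicator (em {Any P u})) via λ {u} {v} eq x →
      Sum.[ Any.++⁺ˡ ∘ indicator-transfer em em eq , Any.++⁺ʳ v ]′ ∘ Any.++⁻ u

    -- A pair in `u ++ x` lies in `u`, lies in `x`, or straddles the cut. So two bits about `u`
    -- suffice: whether it contains a pair, and whether `P` has occurred in it.
    Precedes-finite : (P Q : Pred X 0ℓ) → FiniteIndex (2 * 2) (Precedes P Q)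
    Precedes-finite P Q =
      (λ u → combine (indicator (em {Precedes P Q u})) (indicator (em {Any P u}))) via
      λ {u} {v} eq x →
        let eq₁ , eq₂ = Fin.combine-injective _ _ _ _ eq in
        precedes-++⁺ v
        ∘ Sum.map (indicator-transfer em em eq₁)
            (Sum.map₁ (λ (p , q) → indicator-transfer em em eq₂ p , q))
        ∘ precedes-++⁻ u

    Once-finite : (P : Pred X 0ℓ) → FiniteIndex (2 * (2 * 2)) (Once P)
    Once-finite P = ∩-finite (Any-finite P) (∁-finite (Precedes-finite P P))

-- The class of u is the set of classes of the preimages of u.
Image-finite : ∀ {X Y : Set} → ExcludedMiddle 0ℓ → ∀ {q} {L : Pred (List X) 0ℓ} →
               (g : X → Y) → FiniteIndex q L → FiniteIndex (2 ^ q) (Image g L)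
Image-finite em {L = L} g (h via L-h) =
  (λ u → funToFin (λ i → indicator (em {Reached u i}))) via Reached-transfer
  where
  Reached : _ → _ → Set
  Reached u i = ∃[ v ] (List.map g v ≡ u × h v ≡ i)

  Reached-transfer : ∀ {u u′} →
             funToFin (λ i → indicator (em {Reached u i})) ≡ funToFin (λ i → indicator (em {Reached u′ i})) →
             ∀ x → Image g L (u ++ x) → Image g L (u′ ++ x)
  Reached-transfer {u} {u′} eq x (v , gv≡ux , l)
    -- Cut the preimage where `u` ends. The part above `u` is then exchanged for a word of the same
    -- class above `u′`, which exists because both prefixes reach the same classes.
    with v₁ , v₂ , refl , refl , refl ← map-++⁻ g v u gv≡ux
    with v₁′ , refl , eq′ ← indicator-transfer em em (funToFin-injective _ _ eq (h v₁)) (v₁ , refl , refl)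
    = v₁′ ++ v₂ , List.map-++ g v₁′ v₂ , L-h (sym eq′) v₂ l

-- Tabulated words

Precedes-tabulate : ∀ {X : Set} {P Q : Pred X 0ℓ} {n} (f : Fin n → X) →
                    Precedes P Q (List.tabulate f) ⇔ (∃[ i ] ∃[ j ] (i Fin.< j × P (f i) × Q (f j)))
Precedes-tabulate {X} {P} {Q} f = mk⇔ (⇒ f) (λ (i , j , i<j , p , q) → ⇐ f i j i<j p q)
  where
  ⇒ : ∀ {n} (f : Fin n → X) → Precedes P Q (List.tabulate f) → ∃[ i ] ∃[ j ] (i Fin.< j × P (f i) × Q (f j))
  ⇒ {suc n} f (here p q) with j , q ← Any.tabulate⁻ q = zero , suc j , s≤s z≤n , p , q
  ⇒ {suc n} f (there r) with i , j , i<j , p , q ← ⇒ (f ∘ suc) r = suc i , suc j , s≤s i<j , p , q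

  ⇐ : ∀ {n} (f : Fin n → X) i j → i Fin.< j → P (f i) → Q (f j) → Precedes P Q (List.tabulate f)
  ⇐ f zero    (suc j) _         p q = here p (Any.tabulate⁺ j q)
  ⇐ f (suc i) (suc j) (s≤s i<j) p q = there (⇐ (f ∘ suc) i j i<j p q)

Any-tabulate : ∀ {X : Set} {P : Pred X 0ℓ} {n} (f : Fin n → X) →
               Any P (List.tabulate f) ⇔ (∃[ i ] P (f i))
Any-tabulate f = mk⇔ Any.tabulate⁻ (λ (i , p) → Any.tabulate⁺ i p)

-- The unique position is described by an equivalence at every `j`, which is the form in which
-- `Mark-letterAt` describes the track of a variable.
Once-tabulate : ∀ {X : Set} {P : Pred X 0ℓ} {n} (f : Fin n → X) →
                Once P (List.tabulate f) ⇔ (∃[ i ] (∀ j → P (f j) ⇔ i ≡ j))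
Once-tabulate {P = P} f = mk⇔ ⇒ ⇐
  where
  ⇒ : Once P (List.tabulate f) → ∃[ i ] (∀ j → P (f j) ⇔ i ≡ j)
  ⇒ (any , ¬prec) with i , p ← to (Any-tabulate f) any = i , λ j → mk⇔ (unique j) λ { refl → p }
    where
    unique : ∀ j → P (f j) → i ≡ j
    unique j q with Fin.<-cmp i j
    ... | tri< i<j _ _ = contradiction (from (Precedes-tabulate f) (i , j , i<j , p , q)) ¬prec
    ... | tri≈ _ i≡j _ = i≡j
    ... | tri> _ _ j<i = contradiction (from (Precedes-tabulate f) (j , i , j<i , q , p)) ¬prec

  ⇐ : (∃[ i ] (∀ j → P (f j) ⇔ i ≡ j)) → Once P (List.tabulate f)
  ⇐ (i , at-i) = from (Any-tabulate f) (i , from (at-i i) refl) , λ prec →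
    let j , k , j<k , p , q = to (Precedes-tabulate f) prec in
    Fin.<-irrefl (trans (sym (to (at-i j) p)) (to (at-i k) q)) j<k

-- Lets a preimage of an encoding be treated as a function on the same positions, so that it can be
-- compared with another encoding letter by letter.
map≡tabulate : ∀ {X Y : Set} (g : X → Y) {n} (f : Fin n → Y) v → List.map g v ≡ List.tabulate f →
               Σ[ h ∈ (Fin n → X) ] (v ≡ List.tabulate h × g ∘ h ≗ f)
map≡tabulate g {zero}  f []      eq = (λ ()) , refl , λ ()
map≡tabulate g {suc n} f (x ∷ v) eq
  with h , eq′ , g∘h ← map≡tabulate g (f ∘ suc) v (List.∷-injectiveʳ eq)
  = (λ { zero → x ; (suc i) → h i }) , cong (x ∷_) eq′ ,
    λ { zero → List.∷-injectiveˡ eq ; (suc i) → g∘h i }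

-- Small models

-- A position of a word carries its letter and, for each variable,
-- whether the position is (or belongs to) the value of that variable.
Letter : Set → ℕ → ℕ → Set
Letter A n k = A × Vec Bool n × Vec Bool k

Mark : ∀ {A n k} → Fin n → Pred (Letter A n k) 0ℓ
Mark x (_ , v , _) = lookup v x ≡ true

Member : ∀ {A n k} → Fin k → Pred (Letter A n k) 0ℓ
Member X (_ , _ , s) = lookup s X ≡ true

forget₁ : ∀ {A n k} → Letter A (suc n) k → Letter A n k
forget₁ (c , v , s) = c , Vec.tail v , s

forget₂ : ∀ {A n k} → Letter A n (suc k) → Letter A n k
forget₂ (c , v , s) = c , v , Vec.tail s

letterAt : ∀ {A : Set} {n k} (w : List A) → Vec (Fin (length w)) n → Vec (Subset (length w)) k →
           Fin (length w) → Letter A n k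
letterAt w ρ σ p = List.lookup w p , map (λ x → does (x Fin.≟ p)) ρ , map (λ S → lookup S p) σ

encode : ∀ {A : Set} {n k} (w : List A) → Vec (Fin (length w)) n → Vec (Subset (length w)) k →
         List (Letter A n k)
encode w ρ σ = List.tabulate (letterAt w ρ σ)

does-true : ∀ {P : Set} (p? : Dec P) → does p? ≡ true ⇔ P
does-true (yes p) = mk⇔ (λ _ → p) (λ _ → refl)
does-true (no ¬p) = mk⇔ (λ ()) (λ p → contradiction p ¬p)

does-≡ : ∀ {P : Set} {b} (p? : Dec P) → (b ≡ true ⇔ P) → b ≡ does p?
does-≡ {b = true}  (yes _) _ = refl
does-≡ {b = true}  (no ¬p) e = contradiction (to e refl) ¬p
does-≡ {b = false} (yes p) e = from e p
does-≡ {b = false} (no _)  _ = refl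

module _ {A : Set} {n k} (w : List A) (ρ : Vec (Fin (length w)) n) (σ : Vec (Subset (length w)) k) where

  Mark-letterAt : ∀ x p → Mark x (letterAt w ρ σ p) ⇔ lookup ρ x ≡ p
  Mark-letterAt x p = does-true (lookup ρ x Fin.≟ p) ⇔-∘ ≡⇒⇔ (cong (_≡ true) (Vec.lookup-map x _ ρ))

  Member-letterAt : ∀ X p → Member X (letterAt w ρ σ p) ⇔ p Subset.∈ lookup σ X
  Member-letterAt X p = mk⇔ (Vec.lookup⇒[]= p _) Vec.[]=⇒lookup ⇔-∘ ≡⇒⇔ (cong (_≡ true) (Vec.lookup-map X _ σ))

  -- The mark of `x` sits at the value of `x` and nowhere else, so an occurrence of `Mark x ∩ P`
  -- tests `P` exactly there.
  Any-encode : ∀ x (P : Pred (Letter A n k) 0ℓ) →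
               Any (Mark x ∩ P) (encode w ρ σ) ⇔ P (letterAt w ρ σ (lookup ρ x))
  Any-encode x P = mk⇔ ⇒ λ p →
    from (Any-tabulate _) (lookup ρ x , from (Mark-letterAt x _) refl , p)
    where
    ⇒ : Any (Mark x ∩ P) (encode w ρ σ) → P (letterAt w ρ σ (lookup ρ x))
    ⇒ any with q , m , p ← to (Any-tabulate (letterAt w ρ σ)) any
          with refl ← to (Mark-letterAt x q) m = p

  Once-encode : ∀ x → Once (Mark x) (encode w ρ σ)
  Once-encode x = from (Once-tabulate _) (lookup ρ x , Mark-letterAt x)

  Precedes-encode : ∀ x y → Precedes (Mark x) (Mark y) (encode w ρ σ) ⇔ lookup ρ x Fin.< lookup ρ y
  Precedes-encode x y = mk⇔ ⇒ λ x<y →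
    from (Precedes-tabulate _) (_ , _ , x<y , from (Mark-letterAt x _) refl , from (Mark-letterAt y _) refl)
    where
    ⇒ : Precedes (Mark x) (Mark y) (encode w ρ σ) → lookup ρ x Fin.< lookup ρ y
    ⇒ prec with p , q , p<q , mp , mq ← to (Precedes-tabulate (letterAt w ρ σ)) prec
           with refl ← to (Mark-letterAt x p) mp | refl ← to (Mark-letterAt y q) mq = p<q

  -- A preimage under `forget₁` adds one arbitrary Boolean track. `Once` makes this track the mark
  -- of a single position `p`, and the preimage is then the encoding with `p` as the new value.
  Image-forget₁ : (K : Pred (List (Letter A (suc n) k)) 0ℓ) →
                  Image forget₁ (Once (Mark zero) ∩ K) (encode w ρ σ) ⇔ (∃[ p ] K (encode w (p ∷ ρ) σ))
  Image-forget₁ K = mk⇔ ⇒ λ (p , l) →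
    encode w (p ∷ ρ) σ , List.map-tabulate _ forget₁ , from (Once-tabulate _) (p , Mark-first p) , l
    where
    Mark-first : ∀ p q → Mark zero (letterAt w (p ∷ ρ) σ q) ⇔ p ≡ q
    Mark-first p q = does-true (p Fin.≟ q)

    ⇒ : Image forget₁ (Once (Mark zero) ∩ K) (encode w ρ σ) → ∃[ p ] K (encode w (p ∷ ρ) σ)
    ⇒ (v , eq , once , l)
      with h , refl , fg ← map≡tabulate forget₁ (letterAt w ρ σ) v eq
      with p , at-p ← to (Once-tabulate h) once
      = p , subst K (List.tabulate-cong λ q → extend (h q) (fg q) (at-p q)) l
      where
      extend : ∀ {q} l → forget₁ l ≡ letterAt w ρ σ q → (Mark zero l ⇔ p ≡ q) →
               l ≡ letterAt w (p ∷ ρ) σ q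
      extend {q} (c , b ∷ v , s) refl e = cong (λ b → c , b ∷ v , s) (does-≡ (p Fin.≟ q) e)

  -- Every Boolean track is the characteristic function of a set of positions, so here the preimages
  -- are exactly the encodings with one more set.
  Image-forget₂ : (K : Pred (List (Letter A n (suc k))) 0ℓ) →
                  Image forget₂ K (encode w ρ σ) ⇔ (∃[ S ] K (encode w ρ (S ∷ σ)))
  Image-forget₂ K = mk⇔ ⇒ λ (S , l) → encode w ρ (S ∷ σ) , List.map-tabulate _ forget₂ , l
    where
    ⇒ : Image forget₂ K (encode w ρ σ) → ∃[ S ] K (encode w ρ (S ∷ σ))
    ⇒ (v , eq , l) with h , refl , fg ← map≡tabulate forget₂ (letterAt w ρ σ) v eq =
      Vec.tabulate (first ∘ h) ,
      subst K (List.tabulate-cong λ q → extend {Vec.tabulate (first ∘ h)} (h q) (fg q) (Vec.lookup∘tabulate (first ∘ h) q)) l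
      where
      first : Letter A n (suc k) → Bool
      first (_ , _ , s) = Vec.head s

      extend : ∀ {S q} l → forget₂ l ≡ letterAt w ρ σ q → lookup S q ≡ first l →
               l ≡ letterAt w ρ (S ∷ σ) q
      extend (c , v , b ∷ s) refl e = cong (λ b → c , v , b ∷ s) (sym e)

-- Pumping returns an arbitrary word over `Letter`. If each variable is marked once, the marked
-- positions form an assignment and the first components form the underlying word.
decode : ∀ {A : Set} {n} (u : List (Letter A n 0)) → (∀ i → Once (Mark i) u) →
         ∃[ w ] (length w ≡ length u × (∃[ ρ ] u ≡ encode w ρ []))
decode {n = n} u once
  with h , eq , h≗w ← map≡tabulate proj₁ (List.lookup (List.map proj₁ u)) u
                        (sym (List.tabulate-lookup (List.map proj₁ u)))
  = List.map proj₁ u , List.length-map proj₁ u , Vec.tabulate position ,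
    trans eq (List.tabulate-cong λ p →
      assemble (h p) (h≗w p) (λ i → proj₂ (to (Once-tabulate h) (subst (Once (Mark i)) eq (once i))) p))
  where
  position : Fin n → _
  position i = proj₁ (to (Once-tabulate h) (subst (Once (Mark i)) eq (once i)))

  assemble : ∀ {p} l → proj₁ l ≡ List.lookup (List.map proj₁ u) p → (∀ i → Mark i l ⇔ position i ≡ p) →
             l ≡ letterAt (List.map proj₁ u) (Vec.tabulate position) [] p
  assemble {p} (c , v , []) refl marks = cong (λ v → c , v , []) (begin
    v                                                      ≡⟨ Vec.tabulate∘lookup v ⟨
    Vec.tabulate (lookup v)                                ≡⟨ Vec.tabulate-cong (λ i → does-≡ (position i Fin.≟ p) (marks i)) ⟩
    Vec.tabulate (λ i → does (position i Fin.≟ p))         ≡⟨ Vec.tabulate-∘ _ position ⟩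
    map (λ x → does (x Fin.≟ p)) (Vec.tabulate position)   ∎)
    where open ≡-Reasoning

-- Formulas define encodings of finite index

-- For a first-order quantifier, the factor `2 * (2 * 2)` is the index of `Once`; the power of two
-- comes from projecting a track away.
index : ∀ {L n k} → MSO⁺ L n k → ℕ
index (x <′ y)  = 2 * 2
index (x ≐ y)   = 2
index (x ∈′ X)  = 2
index (θ F xs)  = 2
index (¬′ φ)    = index φ
index (φ ∧′ χ)  = index φ * index χ
index (φ ∨′ χ)  = index φ * index χ
index (∃₁ φ)    = 2 ^ (2 * (2 * 2) * index φ)
index (∀₁ φ)    = 2 ^ (2 * (2 * 2) * index φ)
index (∃₂ φ)    = 2 ^ index φ
index (∀₂ φ)    = 2 ^ index φ

module _ {L : Signature} (M : Structure L) {n : ℕ} (a : Vec (Domain M) n) where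

  -- The proof of `Restricted` serves as data: it tells which arguments of `θ` are prefix variables,
  -- with letters fixed by `a`, and which are `y`, whose letter is `c`.
  argument : ∀ {m} {y : Fin m} {e : Fin n → Fin m} → Domain M →
             ∀ {x} → (Σ[ i ∈ Fin n ] x ≡ e i) ⊎ x ≡ y → Maybe (Domain M)
  argument c (inj₁ (i , _)) = just (lookup a i)
  argument c (inj₂ _)       = just c

  -- `Image` expresses existential quantification only, so universal quantifiers are read as negated
  -- existential ones.
  Encodings : ∀ d {k} (φ : MSO⁺ L (d + n) k) → Restricted n d φ → Pred (List (Letter (Domain M) (d + n) k)) 0ℓ
  Encodings d (x <′ y) r         = Precedes (Mark x) (Mark y)
  Encodings d (x ≐ y)  r         = Any (Mark x ∩ Mark y)
  Encodings d (x ∈′ X) r         = Any (Mark x ∩ Member X)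
  -- With the letters of the prefix variables fixed, the atom is a property of the single letter
  -- marked by `y`.
  Encodings d (θ F xs) (y , r)   = Any (Mark y ∩ λ (c , _) → Sat (expand M) (All.reduce (argument c) r) F)
  Encodings d (¬′ φ)   r         = ∁ (Encodings d φ r)
  Encodings d (φ ∧′ χ) (r , s)   = Encodings d φ r ∩ Encodings d χ s
  Encodings d (φ ∨′ χ) (r , s)   = Encodings d φ r ∪ Encodings d χ s
  Encodings d (∃₁ φ)   r         = Image forget₁ (Once (Mark zero) ∩ Encodings (suc d) φ r)
  Encodings d (∀₁ φ)   r         = ∁ (Image forget₁ (Once (Mark zero) ∩ ∁ (Encodings (suc d) φ r)))
  Encodings d (∃₂ φ)   r         = Image forget₂ (Encodings d φ r)
  Encodings d (∀₂ φ)   r         = ∁ (Image forget₂ (∁ (Encodings d φ r)))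

  Carries : Fin n → Pred (Letter (Domain M) n 0) 0ℓ
  Carries i (c , _) = c ≡ lookup a i

  -- The first condition makes a pumped word decodable; the second keeps the letter at the `i`-th
  -- prefix variable equal to the one that `Encodings` assumes.
  Placed : Fin n → Pred (List (Letter (Domain M) n 0)) 0ℓ
  Placed i = Once (Mark i) ∩ Any (Mark i ∩ Carries i)

  module _ (em : ExcludedMiddle 0ℓ) where

    Placed-finite : ∀ i → FiniteIndex (2 * (2 * 2) * 2) (Placed i)
    Placed-finite i = ∩-finite (Once-finite em _) (Any-finite em _)

    Encodings-finite : ∀ d {k} (φ : MSO⁺ L (d + n) k) r → FiniteIndex (index φ) (Encodings d φ r)
    Encodings-finite d (x <′ y) r       = Precedes-finite em _ _
    Encodings-finite d (x ≐ y)  r       = Any-finite em _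
    Encodings-finite d (x ∈′ X) r       = Any-finite em _
    Encodings-finite d (θ F xs) r       = Any-finite em _
    Encodings-finite d (¬′ φ)   r       = ∁-finite (Encodings-finite d φ r)
    Encodings-finite d (φ ∧′ χ) (r , s) = ∩-finite (Encodings-finite d φ r) (Encodings-finite d χ s)
    Encodings-finite d (φ ∨′ χ) (r , s) = ∪-finite (Encodings-finite d φ r) (Encodings-finite d χ s)
    Encodings-finite d (∃₁ φ)   r       =
      Image-finite em _ (∩-finite (Once-finite em _) (Encodings-finite (suc d) φ r))
    Encodings-finite d (∀₁ φ)   r       =
      ∁-finite (Image-finite em _ (∩-finite (Once-finite em _) (∁-finite (Encodings-finite (suc d) φ r))))
    Encodings-finite d (∃₂ φ)   r       = Image-finite em _ (Encodings-finite d φ r)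
    Encodings-finite d (∀₂ φ)   r       =
      ∁-finite (Image-finite em _ (∁-finite (Encodings-finite d φ r)))

    module _ (w : List (Domain M)) where

      arguments : ∀ d {m y} {xs : Vec (Fin (d + n)) m} (ρ : Vec (Position M w) (d + n)) →
                  (∀ i → List.lookup w (lookup ρ (d ↑ʳ i)) ≡ lookup a i) →
                  (r : All (λ x → (Σ[ i ∈ Fin n ] x ≡ d ↑ʳ i) ⊎ x ≡ y) xs) →
                  map (λ x → just (List.lookup w (lookup ρ x))) xs ≡
                  All.reduce (argument (List.lookup w (lookup ρ y))) r
      arguments d ρ ρ≗a []                      = refl
      arguments d ρ ρ≗a (inj₁ (i , refl) ∷ r)   = cong₂ _∷_ (cong just (ρ≗a i)) (arguments d ρ ρ≗a r)
      arguments d ρ ρ≗a (inj₂ refl ∷ r)         = cong (_ ∷_) (arguments d ρ ρ≗a r)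

      -- By induction on the formula. The hypothesis on `ρ` passes unchanged under a first-order
      -- quantifier, since looking up `suc d ↑ʳ i` in `p ∷ ρ` computes to looking up `d ↑ʳ i` in
      -- `ρ`.
      WordSat⇔Encodings : ∀ d {k} (φ : MSO⁺ L (d + n) k) r ρ σ →
                          (∀ i → List.lookup w (lookup ρ (d ↑ʳ i)) ≡ lookup a i) →
                          WordSat M w ρ σ φ ⇔ Encodings d φ r (encode w ρ σ)
      WordSat⇔Encodings d (x <′ y) r ρ σ ρ≗a = ⇔-sym (Precedes-encode w ρ σ x y)
      WordSat⇔Encodings d (x ≐ y)  r ρ σ ρ≗a =
        ⇔-sym (Any-encode w ρ σ x (Mark y)) ⇔-∘ (⇔-sym (Mark-letterAt w ρ σ y _) ⇔-∘ mk⇔ sym sym)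
      WordSat⇔Encodings d (x ∈′ X) r ρ σ ρ≗a =
        ⇔-sym (Any-encode w ρ σ x (Member X)) ⇔-∘ ⇔-sym (Member-letterAt w ρ σ X _)
      WordSat⇔Encodings d (θ F xs) (y , r) ρ σ ρ≗a =
        ⇔-sym (Any-encode w ρ σ y _) ⇔-∘ ≡⇒⇔ (cong (λ as → Sat (expand M) as F) (arguments d ρ ρ≗a r))
      WordSat⇔Encodings d (¬′ φ)   r ρ σ ρ≗a = ¬-cong-⇔ (WordSat⇔Encodings d φ r ρ σ ρ≗a)
      WordSat⇔Encodings d (φ ∧′ χ) (r , s) ρ σ ρ≗a =
        WordSat⇔Encodings d φ r ρ σ ρ≗a ×-⇔ WordSat⇔Encodings d χ s ρ σ ρ≗a
      WordSat⇔Encodings d (φ ∨′ χ) (r , s) ρ σ ρ≗a =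
        WordSat⇔Encodings d φ r ρ σ ρ≗a ⊎-⇔ WordSat⇔Encodings d χ s ρ σ ρ≗a
      WordSat⇔Encodings d (∃₁ φ)   r ρ σ ρ≗a =
        ⇔-sym (Image-forget₁ w ρ σ _)
        ⇔-∘ ∃-cong-⇔ (λ p → WordSat⇔Encodings (suc d) φ r (p ∷ ρ) σ ρ≗a)
      WordSat⇔Encodings d (∀₁ φ)   r ρ σ ρ≗a =
        ¬-cong-⇔ (⇔-sym (Image-forget₁ w ρ σ _)
                  ⇔-∘ ∃-cong-⇔ (λ p → ¬-cong-⇔ (WordSat⇔Encodings (suc d) φ r (p ∷ ρ) σ ρ≗a)))
        ⇔-∘ ∀⇔¬∃¬ em
      WordSat⇔Encodings d (∃₂ φ)   r ρ σ ρ≗a =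
        ⇔-sym (Image-forget₂ w ρ σ _)
        ⇔-∘ ∃-cong-⇔ (λ S → WordSat⇔Encodings d φ r ρ (S ∷ σ) ρ≗a)
      WordSat⇔Encodings d (∀₂ φ)   r ρ σ ρ≗a =
        ¬-cong-⇔ (⇔-sym (Image-forget₂ w ρ σ _)
                  ⇔-∘ ∃-cong-⇔ (λ S → ¬-cong-⇔ (WordSat⇔Encodings d φ r ρ (S ∷ σ) ρ≗a)))
        ⇔-∘ ∀⇔¬∃¬ em

-- The power is the index of the intersection of the `n` languages `Placed i`.
smallModelBound : ∀ {L n} → MSO⁺ L n 0 → ℕ
smallModelBound {n = n} φ = (2 * (2 * 2) * 2) ^ n * index φ

small-model : ∀ {L} (M : Structure L) → ExcludedMiddle 0ℓ → ∀ {n} (φ : MSO⁺ L n 0) → Restricted n 0 φ →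
              (∃[ w ] ∃[ ρ ] WordSat M w ρ [] φ) →
              ∃[ w ] (length w < smallModelBound φ × (∃[ ρ ] WordSat M w ρ [] φ))
small-model M em φ r (w , ρ , sat)
  with letters ← (λ i → sym (Vec.lookup-map i (List.lookup w) ρ))
  -- The fixed letters are those which the given model has at the prefix variables; they are
  -- generalised to an arbitrary `a` satisfying `letters`.
  with a ← map (List.lookup w) ρ
  with u , u< , placed , enc ← shrink
         (∩-finite (⋂-finite (Placed-finite M a em)) (Encodings-finite M a em 0 φ r))
         (encode w ρ [] ,
          (λ i → Once-encode w ρ [] i , from (Any-encode w ρ [] i (Carries M a i)) (letters i)) ,
          to (WordSat⇔Encodings M a em w 0 φ r ρ [] letters) sat)
  -- The shortened word still satisfies `Placed`: its marks give the new assignment, and its prefix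
  -- letters are still those of `a`.
  with w′ , eq , ρ′ , refl ← decode u (proj₁ ∘ placed)
  = w′ , subst (_< smallModelBound φ) (sym eq) u< , ρ′ ,
    from (WordSat⇔Encodings M a em w′ 0 φ r ρ′ []
           λ i → to (Any-encode w′ ρ′ [] i (Carries M a i)) (proj₂ (placed i))) enc

-- Words of a fixed length

-- The universal quantifier provides a variable even in an empty scope, and the formula also holds
-- in a structure with empty domain.
⊤′ ⊥′ : ∀ {L n} → Formula L n
⊤′ = ∀′ (zero ≐ zero)
⊥′ = ¬′ ⊤′

decided : ∀ {L n} {P : Set} → Dec P → Formula L n
decided (yes _) = ⊤′
decided (no  _) = ⊥′

⋁ : ∀ {L n m} → (Fin m → Formula L n) → Formula L n
⋁ {m = zero}  φ = ⊥′
⋁ {m = suc m} φ = φ zero ∨′ ⋁ (φ ∘ suc)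

⋁ˢ : ∀ {L n m} → (Subset m → Formula L n) → Formula L n
⋁ˢ {m = zero}  φ = φ []
⋁ˢ {m = suc m} φ = ⋁ˢ (φ ∘ (false ∷_)) ∨′ ⋁ˢ (φ ∘ (true ∷_))

exists* : ∀ {L} n → Formula L n → Sentence L
exists* zero    φ = φ
exists* (suc n) φ = exists* n (∃′ φ)

all-just? : ∀ {A : Set} {n} (xs : Vec (Maybe A) n) → Dec (∃[ ys ] xs ≡ map just ys)
all-just? []             = yes ([] , refl)
all-just? (nothing ∷ xs) = no λ { (_ ∷ _ , ()) }
all-just? (just x ∷ xs)  =
  map′ (λ (ys , eq) → x ∷ ys , cong (just x ∷_) eq)
       (λ { (_ ∷ ys , eq) → ys , Vec.∷-injectiveʳ eq })
       (all-just? xs)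

equal : ∀ {L n} → Maybe (Fin n) → Maybe (Fin n) → Formula L n
equal (just x) (just y) = x ≐ y
equal nothing  nothing  = ⊤′
equal _        _        = ⊥′

is-# : ∀ {L n} → Maybe (Fin n) → Formula L n
is-# nothing  = ⊤′
is-# (just _) = ⊥′

bind : ∀ {m n} → Vec (Maybe (Fin n)) m → Vec (Maybe (Fin (suc n))) (suc m)
bind env = just zero ∷ map (Maybe.map suc) env

-- The environment says which variables have the value #, and which
-- variable of the result stands for each of the others.
relativise : ∀ {L m n} → Formula (L ♯) m → Vec (Maybe (Fin n)) m → Formula L n
relativise (rel (old R) xs) env with all-just? (map (lookup env) xs)
... | yes (ys , _)                   = rel R ys
-- Some argument is #, and the symbols of `L` fail on such tuples.
... | no _                           = ⊥′
relativise (rel P# (x ∷ [])) env     = is-# (lookup env x)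
relativise (x ≐ y)           env     = equal (lookup env x) (lookup env y)
relativise (¬′ F)            env     = ¬′ relativise F env
relativise (F ∧′ G)          env     = relativise F env ∧′ relativise G env
relativise (F ∨′ G)          env     = relativise F env ∨′ relativise G env
-- An element of `expand M` is an element of `M` or #, so a quantifier splits into one over `M` and
-- the instance at #.
relativise (∃′ F)            env     =
  (∃′ relativise F (bind env)) ∨′ relativise F (nothing ∷ env)
relativise (∀′ F)            env     =
  (∀′ relativise F (bind env)) ∧′ relativise F (nothing ∷ env)

-- Variable `p` of the result stands for the letter at position `p`. Positions and sets have
-- concrete values here, so order, equality and membership are decided during the translation.
unfold : ∀ {L n k ℓ} → MSO⁺ L n k → Vec (Fin ℓ) n → Vec (Subset ℓ) k → Formula L ℓ
unfold (x <′ y) ρ σ = decided (lookup ρ x Fin.<? lookup ρ y)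
unfold (x ≐ y)  ρ σ = decided (lookup ρ x Fin.≟ lookup ρ y)
unfold (x ∈′ X) ρ σ = decided (lookup ρ x ∈? lookup σ X)
unfold (θ F xs) ρ σ = relativise F (map (just ∘ lookup ρ) xs)
unfold (¬′ φ)   ρ σ = ¬′ unfold φ ρ σ
unfold (φ ∧′ χ) ρ σ = unfold φ ρ σ ∧′ unfold χ ρ σ
unfold (φ ∨′ χ) ρ σ = unfold φ ρ σ ∨′ unfold χ ρ σ
unfold (∃₁ φ)   ρ σ = ⋁ λ p → unfold φ (p ∷ ρ) σ
unfold (∀₁ φ)   ρ σ = ¬′ ⋁ λ p → ¬′ unfold φ (p ∷ ρ) σ
unfold (∃₂ φ)   ρ σ = ⋁ˢ λ S → unfold φ ρ (S ∷ σ)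
unfold (∀₂ φ)   ρ σ = ¬′ ⋁ˢ λ S → ¬′ unfold φ ρ (S ∷ σ)

-- Matching on this view turns the length of a vector into `length w`, so positions need no
-- transport along an equation of lengths.
data FromList {A : Set} : ∀ {n} → Vec A n → Set where
  fromList : (w : List A) → FromList (Vec.fromList w)

fromList-view : ∀ {A : Set} {n} (as : Vec A n) → FromList as
fromList-view []       = fromList []
fromList-view (a ∷ as) with fromList w ← fromList-view as = fromList (a ∷ w)

lookup-fromList : ∀ {A : Set} (w : List A) i → lookup (Vec.fromList w) i ≡ List.lookup w i
lookup-fromList (a ∷ w) zero    = refl
lookup-fromList (a ∷ w) (suc i) = lookup-fromList w i

map-just⁻ : ∀ {A B : Set} {g : A → B} {n} (xs : Vec (Maybe A) n) {bs} → map (Maybe.map g) xs ≡ map just bs →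
            ∃[ ys ] (xs ≡ map just ys × map g ys ≡ bs)
map-just⁻ []            {[]}     eq = [] , refl , refl
map-just⁻ (just x ∷ xs) {b ∷ bs} eq
  with ys , refl , refl ← map-just⁻ xs (Vec.∷-injectiveʳ eq)
  = x ∷ ys , refl , cong (_∷ _) (Maybe.just-injective (Vec.∷-injectiveˡ eq))
map-just⁻ (nothing ∷ xs) {b ∷ bs} ()

map-just-injective : ∀ {A : Set} {n} {xs ys : Vec A n} → map just xs ≡ map just ys → xs ≡ ys
map-just-injective {xs = []}    {[]}    eq = refl
map-just-injective {xs = _ ∷ _} {_ ∷ _} eq =
  cong₂ _∷_ (Maybe.just-injective (Vec.∷-injectiveˡ eq)) (map-just-injective (Vec.∷-injectiveʳ eq))

-- Correctness of the first-order translation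

module _ {L : Signature} (M : Structure L) where

  Sat-⊤′ : ∀ {n} (as : Vec (Domain M) n) → Sat M as ⊤′
  Sat-⊤′ as a = refl

  Sat-⊥′ : ∀ {n} (as : Vec (Domain M) n) → ¬ Sat M as ⊥′
  Sat-⊥′ as ¬⊤ = ¬⊤ (Sat-⊤′ as)

  Sat-decided : ∀ {n} (as : Vec (Domain M) n) {P : Set} (p? : Dec P) → P ⇔ Sat M as (decided p?)
  Sat-decided as (yes p) = mk⇔ (λ _ → Sat-⊤′ as) (λ _ → p)
  Sat-decided as (no ¬p) = mk⇔ (λ p → contradiction p ¬p) (λ s → contradiction s (Sat-⊥′ as))

  Sat-⋁ : ∀ {n m} (as : Vec (Domain M) n) (φ : Fin m → Formula L n) →
          (∃[ i ] Sat M as (φ i)) ⇔ Sat M as (⋁ φ)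
  Sat-⋁ {m = zero}  as φ = mk⇔ (λ ()) (λ s → contradiction s (Sat-⊥′ as))
  Sat-⋁ {m = suc m} as φ = mk⇔
    (λ { (zero , s) → inj₁ s ; (suc i , s) → inj₂ (to (Sat-⋁ as (φ ∘ suc)) (i , s)) })
    (λ { (inj₁ s) → zero , s ; (inj₂ s) → let i , s′ = from (Sat-⋁ as (φ ∘ suc)) s in suc i , s′ })

  Sat-⋁ˢ : ∀ {n m} (as : Vec (Domain M) n) (φ : Subset m → Formula L n) →
           (∃[ S ] Sat M as (φ S)) ⇔ Sat M as (⋁ˢ φ)
  Sat-⋁ˢ {m = zero}  as φ = mk⇔ (λ { ([] , s) → s }) ([] ,_)
  Sat-⋁ˢ {m = suc m} as φ = mk⇔
    (λ { (false ∷ S , s) → inj₁ (to (Sat-⋁ˢ as _) (S , s))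
       ; (true  ∷ S , s) → inj₂ (to (Sat-⋁ˢ as _) (S , s)) })
    (λ { (inj₁ s) → let S , s′ = from (Sat-⋁ˢ as (φ ∘ (false ∷_))) s in false ∷ S , s′
       ; (inj₂ s) → let S , s′ = from (Sat-⋁ˢ as (φ ∘ (true ∷_))) s in true ∷ S , s′ })

  Sat-exists* : ∀ n (φ : Formula L n) → (∃[ as ] Sat M as φ) ⇔ Theory M (exists* n φ)
  Sat-exists* zero    φ = mk⇔ (λ { ([] , s) → s }) ([] ,_)
  Sat-exists* (suc n) φ = Sat-exists* n (∃′ φ) ⇔-∘
    mk⇔ (λ { (a ∷ as , s) → as , a , s }) (λ (as , a , s) → a ∷ as , s)

  values : ∀ {m n} → Vec (Domain M) n → Vec (Maybe (Fin n)) m → Vec (Maybe (Domain M)) m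
  values as = map (Maybe.map (lookup as))

  values-bind : ∀ {m n} a (as : Vec (Domain M) n) (env : Vec (Maybe (Fin n)) m) →
                just a ∷ values as env ≡ values (a ∷ as) (bind env)
  values-bind a as env = cong (just a ∷_) (trans (Vec.map-cong Maybe.map-∘ env) (Vec.map-∘ _ _ env))

  Sat-equal : ∀ {n} (as : Vec (Domain M) n) x y →
              (Maybe.map (lookup as) x ≡ Maybe.map (lookup as) y) ⇔ Sat M as (equal x y)
  Sat-equal as (just x) (just y) = mk⇔ Maybe.just-injective (cong just)
  Sat-equal as (just x) nothing  = mk⇔ (λ ()) (λ s → contradiction s (Sat-⊥′ as))
  Sat-equal as nothing  (just y) = mk⇔ (λ ()) (λ s → contradiction s (Sat-⊥′ as))
  Sat-equal as nothing  nothing  = mk⇔ (λ _ → Sat-⊤′ as) (λ _ → refl)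

  Sat-is-# : ∀ {n} (as : Vec (Domain M) n) x → (Maybe.map (lookup as) x ≡ nothing) ⇔ Sat M as (is-# x)
  Sat-is-# as (just x) = mk⇔ (λ ()) (λ s → contradiction s (Sat-⊥′ as))
  Sat-is-# as nothing  = mk⇔ (λ _ → Sat-⊤′ as) (λ _ → refl)

  Sat-relativise : ∀ {m n} (F : Formula (L ♯) m) (as : Vec (Domain M) n) env →
                   Sat (expand M) (values as env) F ⇔ Sat M as (relativise F env)
  Sat-relativise (rel (old R) xs) as env = rel-case ⇔-∘ ≡⇒⇔ (cong (⟦ expand M ⟧ (old R)) values-lookup)
    where
    values-lookup : map (lookup (values as env)) xs ≡ values as (map (lookup env) xs)
    values-lookup = trans (Vec.map-cong (λ x → Vec.lookup-map x _ env) xs) (Vec.map-∘ _ _ xs)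

    rel-case : ⟦ expand M ⟧ (old R) (values as (map (lookup env) xs)) ⇔ Sat M as (relativise (rel (old R) xs) env)
    rel-case with all-just? (map (lookup env) xs)
    ... | no ¬just = mk⇔
      (λ (_ , eq , _) → let ys , eq′ , _ = map-just⁻ (map (lookup env) xs) eq in contradiction (ys , eq′) ¬just)
      (λ s → contradiction s (Sat-⊥′ as))
    ... | yes (ys , eq) = mk⇔
      (λ (bs , eq′ , r) → subst (⟦ M ⟧ R) (map-just-injective (trans (sym eq′) values-just)) r)
      (λ r → map (lookup as) ys , values-just , r)
      where
      values-just : values as (map (lookup env) xs) ≡ map just (map (lookup as) ys)
      values-just = trans (cong (values as) eq) (trans (sym (Vec.map-∘ _ just ys)) (Vec.map-∘ just _ ys))
  Sat-relativise (rel P# (x ∷ [])) as env =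
    Sat-is-# as (lookup env x) ⇔-∘ ≡⇒⇔ (cong (_≡ nothing) (Vec.lookup-map x _ env))
  Sat-relativise (x ≐ y)  as env =
    Sat-equal as (lookup env x) (lookup env y) ⇔-∘
    ≡⇒⇔ (cong₂ _≡_ (Vec.lookup-map x _ env) (Vec.lookup-map y _ env))
  Sat-relativise (¬′ F)   as env = ¬-cong-⇔ (Sat-relativise F as env)
  Sat-relativise (F ∧′ G) as env = Sat-relativise F as env ×-⇔ Sat-relativise G as env
  Sat-relativise (F ∨′ G) as env = Sat-relativise F as env ⊎-⇔ Sat-relativise G as env
  Sat-relativise (∃′ F)   as env =
    (∃-cong-⇔ (λ a → Sat-relativise F (a ∷ as) (bind env) ⇔-∘
                          ≡⇒⇔ (cong (λ bs → Sat (expand M) bs F) (values-bind a as env)))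
     ⊎-⇔ Sat-relativise F as (nothing ∷ env)) ⇔-∘
    mk⇔ (λ { (just a , s) → inj₁ (a , s) ; (nothing , s) → inj₂ s })
        (λ { (inj₁ (a , s)) → just a , s ; (inj₂ s) → nothing , s })
  Sat-relativise (∀′ F)   as env =
    (∀-cong-⇔ (λ a → Sat-relativise F (a ∷ as) (bind env) ⇔-∘
                          ≡⇒⇔ (cong (λ bs → Sat (expand M) bs F) (values-bind a as env)))
     ×-⇔ Sat-relativise F as (nothing ∷ env)) ⇔-∘
    mk⇔ (λ s → (λ a → s (just a)) , s nothing) (λ { (s , t) (just a) → s a ; (s , t) nothing → t })

  -- Excluded middle enters at the universal quantifiers, which `unfold` turns into negated
  -- disjunctions.
  Sat-unfold : ExcludedMiddle 0ℓ → ∀ {n k} (φ : MSO⁺ L n k) w ρ σ →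
               WordSat M w ρ σ φ ⇔ Sat M (Vec.fromList w) (unfold φ ρ σ)
  Sat-unfold em (x <′ y) w ρ σ = Sat-decided _ (lookup ρ x Fin.<? lookup ρ y)
  Sat-unfold em (x ≐ y)  w ρ σ = Sat-decided _ (lookup ρ x Fin.≟ lookup ρ y)
  Sat-unfold em (x ∈′ X) w ρ σ = Sat-decided _ (lookup ρ x ∈? lookup σ X)
  Sat-unfold em (θ F xs) w ρ σ =
    Sat-relativise F (Vec.fromList w) (map (just ∘ lookup ρ) xs) ⇔-∘
    ≡⇒⇔ (cong (λ as → Sat (expand M) as F)
      (trans (Vec.map-cong (λ x → cong just (sym (lookup-fromList w (lookup ρ x)))) xs) (Vec.map-∘ _ _ xs)))
  Sat-unfold em (¬′ φ)   w ρ σ = ¬-cong-⇔ (Sat-unfold em φ w ρ σ)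
  Sat-unfold em (φ ∧′ χ) w ρ σ = Sat-unfold em φ w ρ σ ×-⇔ Sat-unfold em χ w ρ σ
  Sat-unfold em (φ ∨′ χ) w ρ σ = Sat-unfold em φ w ρ σ ⊎-⇔ Sat-unfold em χ w ρ σ
  Sat-unfold em (∃₁ φ)   w ρ σ = Sat-⋁ _ _ ⇔-∘ ∃-cong-⇔ (λ p → Sat-unfold em φ w (p ∷ ρ) σ)
  Sat-unfold em (∀₁ φ)   w ρ σ =
    ¬-cong-⇔ (Sat-⋁ _ (λ p → ¬′ unfold φ (p ∷ ρ) σ) ⇔-∘
              ∃-cong-⇔ (λ p → ¬-cong-⇔ (Sat-unfold em φ w (p ∷ ρ) σ))) ⇔-∘
    ∀⇔¬∃¬ em
  Sat-unfold em (∃₂ φ)   w ρ σ = Sat-⋁ˢ _ _ ⇔-∘ ∃-cong-⇔ (λ S → Sat-unfold em φ w ρ (S ∷ σ))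
  Sat-unfold em (∀₂ φ)   w ρ σ =
    ¬-cong-⇔ (Sat-⋁ˢ _ (λ S → ¬′ unfold φ ρ (S ∷ σ)) ⇔-∘
              ∃-cong-⇔ (λ S → ¬-cong-⇔ (Sat-unfold em φ w ρ (S ∷ σ)))) ⇔-∘
    ∀⇔¬∃¬ em

  WordSat-∃* : ∀ w n (φ : MSO⁺ L n 0) → (∃[ ρ ] WordSat M w ρ [] φ) ⇔ WordSat M w [] [] (∃* n φ)
  WordSat-∃* w zero    φ = mk⇔ (λ { ([] , s) → s }) ([] ,_)
  WordSat-∃* w (suc n) φ = WordSat-∃* w n (∃₁ φ) ⇔-∘
    mk⇔ (λ { (p ∷ ρ , s) → ρ , p , s }) (λ (ρ , p , s) → p ∷ ρ , s)

-- The reduction to the first-order theory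

satisfiableAt : ∀ {L} → MSO⁺ L 0 0 → ℕ → Sentence L
satisfiableAt ψ ℓ = exists* ℓ (unfold ψ [] [])

satisfiableAt-correct : ∀ {L} (M : Structure L) → ExcludedMiddle 0ℓ → ∀ ψ ℓ →
                        (∃[ w ] (length w ≡ ℓ × Language M ψ w)) ⇔ Theory M (satisfiableAt ψ ℓ)
satisfiableAt-correct M em ψ ℓ = Sat-exists* M ℓ (unfold ψ [] []) ⇔-∘
  mk⇔ (λ { (w , refl , sat) → Vec.fromList w , to (Sat-unfold M em ψ w [] []) sat }) (λ (as , s) → ⇐ as s)
  where
  -- The length is generalised so that the view can replace it by `length w`.
  ⇐ : ∀ {ℓ} (as : Vec (Domain M) ℓ) → Sat M as (unfold ψ [] []) → ∃[ w ] (length w ≡ ℓ × Language M ψ w)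
  ⇐ as s with fromList w ← fromList-view as = w , refl , from (Sat-unfold M em ψ w [] []) s

-- The lengths tried are those strictly below the small model bound, with the empty word included.
-- The bound depends on the formula alone, so one sentence serves all structures.
satisfiable : ∀ {L} → MSO⁺R L → Sentence L
satisfiable (ψ , n , φ , _) = ⋁ {m = smallModelBound φ} (satisfiableAt ψ ∘ toℕ)

satisfiable-correct : ∀ {L} (M : Structure L) → ExcludedMiddle 0ℓ → satisfiable Reduces Emptiness M To Theory M
satisfiable-correct M em (ψ , n , φ , r , refl) =
  Sat-⋁ M {m = smallModelBound φ} [] (satisfiableAt ψ ∘ toℕ) ⇔-∘
  mk⇔ (λ (w , sat) → ⇒ (small-model M em φ r (w , from (WordSat-∃* M w n φ) sat)))
      (λ (ℓ , s) → let w , _ , sat = from (satisfiableAt-correct M em ψ (toℕ ℓ)) s in w , sat)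
  where
  ⇒ : (∃[ w ] (length w < smallModelBound φ × (∃[ ρ ] WordSat M w ρ [] φ))) →
      ∃[ ℓ ] Theory M (satisfiableAt ψ (toℕ {smallModelBound φ} ℓ))
  ⇒ (w , short , sat) = fromℕ< short ,
    to (satisfiableAt-correct M em ψ (toℕ (fromℕ< short)))
      (w , sym (Fin.toℕ-fromℕ< short) , to (WordSat-∃* M w n φ) sat)

theorem6p6 : (L : Signature) →
    (Σ[ f ∈ (MSO⁺R L → Sentence L) ]
    ((M : Structure L) → ExcludedMiddle 0ℓ →
    f Reduces Emptiness M To Theory M))
    ×
    ((d : Sentence L → Bool) →
    Σ[ e ∈ (MSO⁺R L → Bool) ]
    ((M : Structure L) → ExcludedMiddle 0ℓ →
    d Decides Theory M → e Decides Emptiness M))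
theorem6p6 L =
  (satisfiable , satisfiable-correct) ,
  λ d → d ∘ satisfiable , λ M em d-decides ψ → Reflects-⇔ (satisfiable-correct M em ψ) (d-decides (satisfiable ψ))
  where
  Reflects-⇔ : ∀ {P Q : Set} {b} → P ⇔ Q → Reflects Q b → Reflects P b
  Reflects-⇔ P⇔Q (Reflects.ofʸ q)  = Reflects.ofʸ (from P⇔Q q)
  Reflects-⇔ P⇔Q (Reflects.ofⁿ ¬q) = Reflects.ofⁿ (¬q ∘ to P⇔Q)
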